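{- Let $Q$ be an idempotent quasigroup (finite or infinite). Then $Q$ is a DTS quasigroup if and only if all $x,y\in Q$ satisfy both of the following conditions: (i) $x\cdot xy = y = yx\cdot x$ or $xy\cdot x = y = x\cdot yx$; and (ii) $xy\cdot x = y$ implies $xy\cdot y = x$.
   Context: Juxtaposition binds tighter than the dot: $x\cdot xy$ means $x(xy)$, $xy\cdot x$ means $(xy)x$, etc. A quasigroup is a set with a binary operation such that for all $a,b$ the equations $au=b$ and $va=b$ have unique solutions $u,v$; it is idempotent if $xx=x$ for all $x$. A directed triple $\langle x,y,z\rangle$ ($x,y,z$ pairwise distinct) stands for the set of arrows $\{(x,y),(y,z),(x,z)\}$. A directed triple system (DTS) on a set $X$ (finite or infinite) is a set $\mathcal D$ of directed triples of elements of $X$ such that each ordered pair $(a,b)$ with $a\neq b$ in $X$ is an arrow of exactly one triple of $\mathcal D$. It induces a binary operation on $X$: $xx=x$ for all $x\in X$, and $xy=z$, $yz=x$, $xz=y$ whenever $\langle x,y,z\rangle\in\mathcal D$. If $X$ with this operation is a quasigroup, then $\mathcal D$ is called a Latin directed triple system (LDTS), and a quasigroup obtained in this way from some LDTS is called a DTS quasigroup. -}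

module Defs where

open import Level using (Level; _⊔_; suc)
open import Algebra.Bundles using (Quasigroup)
open import Algebra.Core using (Op₂)
open import Algebra.Definitions using (Idempotent)
open import Algebra.Structures using (IsQuasigroup)
open import Data.Product using (_×_; ∃; ∃₂; ∃!)
open import Data.Sum using (_⊎_)
open import Relation.Binary.Bundles using (Setoid)
open import Relation.Binary.Core using (Rel)
open import Relation.Binary.Definitions using (_Respects_)
open import Relation.Unary using (Pred; _∈_)

-- A set X is modelled by a setoid, as in Algebra.Bundles.
module DirectedTriples {c ℓ : Level} (X : Setoid c ℓ) where

  open Setoid X using (_≈_; _≉_) renaming (Carrier to A)

  record DirectedTriple : Set (c ⊔ ℓ) where
    constructor ⟨_,_,_⟩[_,_,_]
    field
      first second third : A
      first≉second : first ≉ second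
      second≉third : second ≉ third
      first≉third  : first ≉ third

  open DirectedTriple

  -- Componentwise equality ignores the distinctness proofs.  It agrees with
  -- equality of the associated sets of arrows, because the arrows linearly
  -- order the three points.
  infix 4 _≈ₜ_
  _≈ₜ_ : Rel DirectedTriple ℓ
  s ≈ₜ t = first s ≈ first t × second s ≈ second t × third s ≈ third t

  IsArrow : A → A → Pred DirectedTriple ℓ
  IsArrow a b t = (a ≈ first t × b ≈ second t)
                ⊎ (a ≈ second t × b ≈ third t)
                ⊎ (a ≈ first t × b ≈ third t)

  record IsDTS (D : Pred DirectedTriple ℓ) : Set (c ⊔ ℓ) where
    field
      respects-≈ₜ : D Respects _≈ₜ_
      exactlyOne  : ∀ a b → a ≉ b → ∃! _≈ₜ_ (λ t → t ∈ D × IsArrow a b t)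

  -- When D is a directed triple system every ordered pair of distinct points
  -- is an arrow of exactly one triple, so at most one operation (up to _≈_)
  -- satisfies this specification.
  record Induces (D : Pred DirectedTriple ℓ) (_∙_ : Op₂ A) : Set (c ⊔ ℓ) where
    field
      idem : Idempotent _≈_ _∙_
      xy≈z : ∀ t → t ∈ D → (first t ∙ second t) ≈ third t
      yz≈x : ∀ t → t ∈ D → (second t ∙ third t) ≈ first t
      xz≈y : ∀ t → t ∈ D → (first t ∙ third t) ≈ second t

  record IsLDTS (D : Pred DirectedTriple ℓ) : Set (c ⊔ ℓ) where
    field
      isDTS : IsDTS D
      latin : ∃ λ (_∙_ : Op₂ A) →
                Induces D _∙_ ×
                (∃₂ λ (_\\_ _//_ : Op₂ A) → IsQuasigroup _≈_ _∙_ _\\_ _//_)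

IsDTSQuasigroup : ∀ {c ℓ} → Quasigroup c ℓ → Set (c ⊔ suc ℓ)
IsDTSQuasigroup Q = ∃ λ D → IsLDTS D × Induces D _∙_
  where
  open Quasigroup Q using (setoid; _∙_)
  open DirectedTriples setoid

{-# OPTIONS --safe #-}
-- For a ≠ b put c = ab; the triple with arrow (a,b) can only be ⟨a,b,c⟩,
-- ⟨c,a,b⟩ or ⟨a,c,b⟩.  In a DTS quasigroup, comparing the triple of (x,y) with
-- that of (y,x) and cancelling shows that a failure of (i) would put one arrow
-- into two triples; for (ii) compare the triples of (x,y) and (xy,x).
-- Conversely, (i) and (ii) make at least one of the three orders compatible
-- with the products, and if two are, then all six orders of {a,b,c} are.  Such
-- a totally symmetric block is covered by two mutually reverse triples, so all
-- that has to be chosen is the middle point of the block.  The choice has to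
-- depend on the block only: excluded middle on types acts as a choice operator,
-- and function extensionality makes it insensitive to how the block is given.
module Submission where

open import Defs
open import Level using (Level; _⊔_; 0ℓ; lift; lower)
open import Algebra.Bundles using (Quasigroup)
open import Algebra.Definitions using (Idempotent)
import Algebra.Properties.Quasigroup as QuasigroupProperties
open import Axiom.ExcludedMiddle using (ExcludedMiddle)
open import Axiom.Extensionality.Propositional using (Extensionality)
open import Data.Bool.Base using (Bool; T)
open import Data.Bool.Properties using (⇔→≡; T-≡)
open import Data.Product using (_×_; _,_; ∃; ∃!; proj₁; proj₂)
open import Data.Sum using (_⊎_; inj₁; inj₂)
open import Function.Base using (_∘_)
open import Function.Bundles using (_⇔_; mk⇔; Equivalence)
import Function.Properties.Equivalence as ⇔
open import Relation.Binary.Definitions using (_Respects_)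
open import Relation.Binary.PropositionalEquality as ≡ using (_≡_)
open import Relation.Nullary using (¬_; Dec; yes; no; contradiction)
open import Relation.Nullary.Decidable using (isYes; map′; toWitness; fromWitness)
open import Relation.Unary using (Pred; _∈_)

-- Extensional choice from excluded middle.

lower-em : ∀ {p} q → ExcludedMiddle (p ⊔ q) → ExcludedMiddle p
lower-em q em = map′ lower (lift {ℓ = q}) em

module ExtensionalChoice {c ℓ : Level} (em : ExcludedMiddle (c ⊔ ℓ))
                         (ext : Extensionality c 0ℓ) {A : Set c} where

  -- Boolean codes let function extensionality identify equivalent predicates; for the predicates
  -- themselves it would leave equalities between types to prove.
  characteristic : Pred A ℓ → A → Bool
  characteristic P a = isYes (lower-em c em {P a})

  T-characteristic : ∀ P a → T (characteristic P a) ⇔ P a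
  T-characteristic P a = mk⇔ (toWitness {a? = lower-em c em})
                             (fromWitness {a? = lower-em c em})

  characteristic-cong : ∀ {P Q} → (∀ a → P a ⇔ Q a) →
                        characteristic P ≡ characteristic Q
  characteristic-cong {P} {Q} P⇔Q = ext λ a → ⇔→≡
    (⇔.trans (⇔.sym T-≡) (⇔.trans (T-characteristic P a)
      (⇔.trans (P⇔Q a) (⇔.trans (⇔.sym (T-characteristic Q a)) T-≡))))

  -- The point returned is the one found by the decision; the given witness only refutes a negative
  -- decision. Hence the result depends on `f` and the decision alone.
  select : (f : A → Bool) → Dec (∃ (T ∘ f)) → ∃ (T ∘ f) → ∃ (T ∘ f)
  select f (yes w) _ = w
  select f (no ¬w) w = contradiction w ¬w

  select-irrelevant : ∀ f d w w′ → select f d w ≡ select f d w′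
  select-irrelevant f (yes _) _ _  = ≡.refl
  select-irrelevant f (no ¬w) w _  = contradiction w ¬w

  encode : ∀ P → ∃ P → ∃ (T ∘ characteristic P)
  encode P (a , p) = a , Equivalence.from (T-characteristic P a) p

  choose : (P : Pred A ℓ) → ∃ P → A
  choose P w = proj₁ (select _ (lower-em ℓ em) (encode P w))

  choose-∈ : ∀ P w → choose P w ∈ P
  choose-∈ P w = Equivalence.to (T-characteristic P _)
                   (proj₂ (select _ (lower-em ℓ em) (encode P w)))

  choose-cong : ∀ {P Q} w w′ → (∀ a → P a ⇔ Q a) → choose P w ≡ choose Q w′
  choose-cong {P} {Q} w w′ P⇔Q =
    helper (characteristic-cong P⇔Q) (encode P w) (encode Q w′)
    where
    -- The two codes are generalised to variables so that their equality can be matched with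
    -- `≡.refl`.
    helper : ∀ {f g} → f ≡ g → ∀ u v → proj₁ (select f (lower-em ℓ em) u)
                                     ≡ proj₁ (select g (lower-em ℓ em) v)
    helper ≡.refl u v = ≡.cong proj₁ (select-irrelevant _ (lower-em ℓ em) u v)

module _ {c ℓ : Level} (Q : Quasigroup c ℓ) where
  open Quasigroup Q
  open QuasigroupProperties Q using (cancelˡ; cancelʳ)
  open DirectedTriples setoid
  open DirectedTriple

  ConditionI : Carrier → Carrier → Set ℓ
  ConditionI x y = (x ∙ (x ∙ y) ≈ y × y ≈ (y ∙ x) ∙ x)
                 ⊎ ((x ∙ y) ∙ x ≈ y × y ≈ x ∙ (y ∙ x))

  ConditionII : Carrier → Carrier → Set ℓ
  ConditionII x y = (x ∙ y) ∙ x ≈ y → (x ∙ y) ∙ y ≈ x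

  -- Necessity of (i) and (ii).

  module DTS⇒Conditions (em : ExcludedMiddle (c ⊔ ℓ)) {D : Pred DirectedTriple ℓ}
                        (isDTS : IsDTS D) (induces : Induces D _∙_) where

    open IsDTS isDTS
    open Induces induces

    -- Working up to `_≈_` allows any expression for a point, such as `a ∙ b`, without rebuilding
    -- distinctness proofs.
    Contains : Carrier → Carrier → Carrier → Set (c ⊔ ℓ)
    Contains x y z = ∃ λ t → t ∈ D × x ≈ first t × y ≈ second t × z ≈ third t

    data Arrow (a b x y z : Carrier) : Set ℓ where
      first-second : a ≈ x → b ≈ y → Arrow a b x y z
      second-third : a ≈ y → b ≈ z → Arrow a b x y z
      first-third  : a ≈ x → b ≈ z → Arrow a b x y z

    module _ {x y z : Carrier} where

      product₁₂ : Contains x y z → x ∙ y ≈ z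
      product₁₂ (t , t∈D , p , q , r) = trans (∙-cong p q) (trans (xy≈z t t∈D) (sym r))

      product₂₃ : Contains x y z → y ∙ z ≈ x
      product₂₃ (t , t∈D , p , q , r) = trans (∙-cong q r) (trans (yz≈x t t∈D) (sym p))

      product₁₃ : Contains x y z → x ∙ z ≈ y
      product₁₃ (t , t∈D , p , q , r) = trans (∙-cong p r) (trans (xz≈y t t∈D) (sym q))

      isArrow : ∀ {a b} → (o : Contains x y z) → Arrow a b x y z → IsArrow a b (proj₁ o)
      isArrow (_ , _ , p , q , r) (first-second u v) = inj₁ (trans u p , trans v q)
      isArrow (_ , _ , p , q , r) (second-third u v) = inj₂ (inj₁ (trans u q , trans v r))
      isArrow (_ , _ , p , q , r) (first-third u v)  = inj₂ (inj₂ (trans u p , trans v r))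

    isArrow⇒≉ : ∀ {a b} t → IsArrow a b t → a ≉ b
    isArrow⇒≉ t (inj₁ (p , q)) a≈b        = first≉second t (trans (sym p) (trans a≈b q))
    isArrow⇒≉ t (inj₂ (inj₁ (p , q))) a≈b = second≉third t (trans (sym p) (trans a≈b q))
    isArrow⇒≉ t (inj₂ (inj₂ (p , q))) a≈b = first≉third t (trans (sym p) (trans a≈b q))

    -- Both triples agree with the one that `exactlyOne` supplies for `(a,b)`. Every impossible case
    -- below is refuted by this comparison, which forces `x ≈ y`.
    unique : ∀ {a b x y z x′ y′ z′} → Contains x y z → Arrow a b x y z →
             Contains x′ y′ z′ → Arrow a b x′ y′ z′ → x ≈ x′ × y ≈ y′ × z ≈ z′
    unique {a} {b} o@(t , t∈D , p , q , r) i o′@(_ , t′∈D , p′ , q′ , r′) i′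
      with exactlyOne a b (isArrow⇒≉ t (isArrow o i))
    ... | _ , _ , only with only (t∈D , isArrow o i) | only (t′∈D , isArrow o′ i′)
    ... | u , v , w | u′ , v′ , w′ =
      join p u u′ p′ , join q v v′ q′ , join r w w′ r′
      where
      join : ∀ {k l m n s} → k ≈ l → m ≈ l → m ≈ n → s ≈ n → k ≈ s
      join k≈l m≈l m≈n s≈n = trans k≈l (trans (sym m≈l) (trans m≈n (sym s≈n)))

    tripleOf : ∀ {a b} → a ≉ b →
               Contains a b (a ∙ b) ⊎ Contains (a ∙ b) a b ⊎ Contains a (a ∙ b) b
    tripleOf {a} {b} a≉b with exactlyOne a b a≉b
    ... | t , (t∈D , inj₁ (p , q)) , _ =
      inj₁ (t , t∈D , p , q , trans (∙-cong p q) (xy≈z t t∈D))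
    ... | t , (t∈D , inj₂ (inj₁ (p , q))) , _ =
      inj₂ (inj₁ (t , t∈D , trans (∙-cong p q) (yz≈x t t∈D) , p , q))
    ... | t , (t∈D , inj₂ (inj₂ (p , q))) , _ =
      inj₂ (inj₂ (t , t∈D , p , trans (∙-cong p q) (xz≈y t t∈D) , q))

    -- The triple of `(x,y)` gives `x ∙ (x ∙ y) ≈ y`, or, if `x ∙ y` comes first, `(x ∙ y) ∙ x ≈ y`.
    -- That of `(y,x)` gives `(y ∙ x) ∙ x ≈ y`, or, if `y ∙ x` comes last, `x ∙ (y ∙ x) ≈ y`.
    -- Matching outcomes form an alternative of (i).
    conditionI-≉ : ∀ {x y} → x ≉ y → ConditionI x y
    conditionI-≉ {x} {y} x≉y with tripleOf x≉y | tripleOf (x≉y ∘ sym)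
    ... | inj₁ o        | inj₂ (inj₁ o′) = inj₁ (product₁₃ o , sym (product₁₃ o′))
    ... | inj₁ o        | inj₂ (inj₂ o′) = inj₁ (product₁₃ o , sym (product₂₃ o′))
    ... | inj₂ (inj₂ o) | inj₂ (inj₁ o′) = inj₁ (product₁₂ o , sym (product₁₃ o′))
    ... | inj₂ (inj₂ o) | inj₂ (inj₂ o′) = inj₁ (product₁₂ o , sym (product₂₃ o′))
    ... | inj₂ (inj₁ o) | inj₁ o′        = inj₂ (product₁₂ o , sym (product₂₃ o′))
    -- In the four mixed cases cancelling `x` gives `x ∙ y ≈ y ∙ x`, so the two triples share the
    -- arrow `(x, x ∙ y)` or `(x ∙ y, x)`.
    ... | inj₁ o        | inj₁ o′ = contradiction (proj₁ x≈y) x≉y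
      where
      xy≈yx = cancelˡ x _ _ (trans (product₁₃ o) (sym (product₂₃ o′)))
      x≈y = unique o (first-third refl refl) o′ (second-third refl xy≈yx)
    ... | inj₂ (inj₂ o) | inj₁ o′ = contradiction (proj₁ x≈y) x≉y
      where
      xy≈yx = cancelˡ x _ _ (trans (product₁₂ o) (sym (product₂₃ o′)))
      x≈y = unique o (first-second refl refl) o′ (second-third refl xy≈yx)
    ... | inj₂ (inj₁ o) | inj₂ (inj₁ o′) = contradiction (proj₁ (proj₂ x≈y)) x≉y
      where
      xy≈yx = cancelʳ x _ _ (trans (product₁₂ o) (sym (product₁₃ o′)))
      x≈y = unique o (first-second refl refl) o′ (first-third xy≈yx refl)
    ... | inj₂ (inj₁ o) | inj₂ (inj₂ o′) = contradiction (sym (proj₂ (proj₂ y≈x))) x≉y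
      where
      xy≈yx = cancelʳ x _ _ (trans (product₁₂ o) (sym (product₂₃ o′)))
      y≈x = unique o (first-second refl refl) o′ (second-third xy≈yx refl)

    conditionII-≉ : ∀ {x y} → x ≉ y → ConditionII x y
    conditionII-≉ {x} {y} x≉y xy∙x≈y with tripleOf x≉y
    ... | inj₂ (inj₁ o) = product₁₃ o
    ... | inj₂ (inj₂ o) = product₂₃ o
    -- With `x ∙ y` last, the triple of `(x ∙ y, x)` has third point `y` by assumption. If `y` is
    -- last or first there, it shares `(x,y)` or `(y, x ∙ y)` with `o`; with `y` in the middle it
    -- yields the claim.
    ... | inj₁ o@(t , _ , p , _ , r)
      with tripleOf (λ xy≈x → first≉third t (trans (sym p) (trans (sym xy≈x) r)))
    ... | inj₁ o′ = contradiction (sym (proj₁ (proj₂ y≈x))) x≉y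
      where
      y≈x = unique o (first-second refl refl) o′ (second-third refl (sym xy∙x≈y))
    ... | inj₂ (inj₁ o′) = contradiction (trans (proj₁ x≈xy∙x) xy∙x≈y) x≉y
      where
      x≈xy∙x = unique o (second-third refl refl) o′ (first-second (sym xy∙x≈y) refl)
    ... | inj₂ (inj₂ o′) = trans (∙-congˡ (sym xy∙x≈y)) (product₁₂ o′)

    module _ (x y : Carrier) where

      conditionI-≈ : x ≈ y → ConditionI x y
      conditionI-≈ x≈y = inj₁ (trans (∙-congˡ xy≈y) xy≈y , sym (trans (∙-congʳ yx≈y) yx≈y))
        where
        xy≈y = trans (∙-congʳ x≈y) (idem y)
        yx≈y = trans (∙-congˡ x≈y) (idem y)

      conditionII-≈ : x ≈ y → ConditionII x y
      conditionII-≈ x≈y _ =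
        trans (∙-congʳ (trans (∙-congʳ x≈y) (idem y))) (trans (idem y) (sym x≈y))

      conditions : ConditionI x y × ConditionII x y
      conditions with lower-em c em {x ≈ y}
      ... | yes x≈y = conditionI-≈ x≈y , conditionII-≈ x≈y
      ... | no x≉y  = conditionI-≉ x≉y , conditionII-≉ x≉y

  -- Sufficiency of (i) and (ii).

  module Conditions⇒DTS (em : ExcludedMiddle (c ⊔ ℓ)) (ext : Extensionality c 0ℓ)
                        (idem : Idempotent _≈_ _∙_)
                        (conditionI : ∀ x y → ConditionI x y)
                        (conditionII : ∀ x y → ConditionII x y) where

    open ExtensionalChoice {c} {ℓ} em ext {Carrier}

    Compatible : Carrier → Carrier → Carrier → Set ℓ
    Compatible x y z = x ∙ y ≈ z × y ∙ z ≈ x × x ∙ z ≈ y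

    -- By Commuting-rotate and Commuting-swap, this is total symmetry of {x,y,z}.
    Commuting : Carrier → Carrier → Carrier → Set ℓ
    Commuting x y z = x ∙ y ≈ z × y ∙ x ≈ z

    Commuting-swap : ∀ {x y z} → Commuting x y z → Commuting y x z
    Commuting-swap (p , q) = q , p

    -- Since `x ∙ y` and `y ∙ x` are both `z`, either alternative of (i) for `(y,x)` evaluates both
    -- products of `y` and `z` to `x`.
    Commuting-rotate : ∀ {x y z} → Commuting x y z → Commuting y z x
    Commuting-rotate {x} {y} (xy≈z , yx≈z) with conditionI y x
    ... | inj₁ (p , q) = trans (∙-congˡ (sym yx≈z)) p , trans (∙-congʳ (sym xy≈z)) (sym q)
    ... | inj₂ (p , q) = trans (∙-congˡ (sym xy≈z)) (sym q) , trans (∙-congʳ (sym yx≈z)) p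

    Commuting⇒Compatible : ∀ {x y z} → Commuting x y z → Compatible x y z
    Commuting⇒Compatible com =
      proj₁ com , proj₁ (Commuting-rotate com) ,
      proj₂ (Commuting-rotate (Commuting-rotate com))

    Compatible-resp : ∀ {x y z x′ y′ z′} → x ≈ x′ → y ≈ y′ → z ≈ z′ →
                      Compatible x y z → Compatible x′ y′ z′
    Compatible-resp p q r (xy≈z , yz≈x , xz≈y) =
      move p q xy≈z r , move q r yz≈x p , move p r xz≈y q
      where
      move : ∀ {k l m k′ l′ m′} → k ≈ k′ → l ≈ l′ → k ∙ l ≈ m → m ≈ m′ → k′ ∙ l′ ≈ m′
      move k≈k′ l≈l′ kl≈m m≈m′ =
        trans (∙-cong (sym k≈k′) (sym l≈l′)) (trans kl≈m m≈m′)

    Commuting-resp : ∀ {x y z x′ y′ z′} → x ≈ x′ → y ≈ y′ → z ≈ z′ →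
                     Commuting x y z → Commuting x′ y′ z′
    Commuting-resp p q r (xy≈z , yx≈z) =
      trans (∙-cong (sym p) (sym q)) (trans xy≈z r) ,
      trans (∙-cong (sym q) (sym p)) (trans yx≈z r)

    -- A midpoint for each block.

    Block : Carrier → Carrier → Carrier → Pred Carrier ℓ
    Block x y z m = m ≈ x ⊎ m ≈ y ⊎ m ≈ z

    Block-rotate : ∀ {x y z m} → Block x y z m → Block y z x m
    Block-rotate (inj₁ p)        = inj₂ (inj₂ p)
    Block-rotate (inj₂ (inj₁ p)) = inj₁ p
    Block-rotate (inj₂ (inj₂ p)) = inj₂ (inj₁ p)

    Block-swap : ∀ {x y z m} → Block x y z m → Block x z y m
    Block-swap (inj₁ p)        = inj₁ p
    Block-swap (inj₂ (inj₁ p)) = inj₂ (inj₂ p)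
    Block-swap (inj₂ (inj₂ p)) = inj₂ (inj₁ p)

    Block-resp : ∀ {x y z x′ y′ z′ m} → x ≈ x′ → y ≈ y′ → z ≈ z′ →
                 Block x y z m → Block x′ y′ z′ m
    Block-resp p q r (inj₁ m≈x)        = inj₁ (trans m≈x p)
    Block-resp p q r (inj₂ (inj₁ m≈y)) = inj₂ (inj₁ (trans m≈y q))
    Block-resp p q r (inj₂ (inj₂ m≈z)) = inj₂ (inj₂ (trans m≈z r))

    -- Permuting the points or replacing them by equal ones yields an equivalent predicate `Block`,
    -- so `choose-cong` makes the midpoint an invariant of the block. The witness `x` merely shows
    -- that the block is inhabited.
    midpoint : Carrier → Carrier → Carrier → Carrier
    midpoint x y z = choose (Block x y z) (x , inj₁ refl)

    midpoint∈Block : ∀ x y z → Block x y z (midpoint x y z)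
    midpoint∈Block x y z = choose-∈ (Block x y z) (x , inj₁ refl)

    midpoint-rotate : ∀ x y z → midpoint x y z ≈ midpoint y z x
    midpoint-rotate x y z = reflexive (choose-cong _ _ λ _ →
      mk⇔ Block-rotate (Block-rotate ∘ Block-rotate))

    midpoint-swap : ∀ x y z → midpoint x y z ≈ midpoint x z y
    midpoint-swap x y z = reflexive (choose-cong _ _ λ _ → mk⇔ Block-swap Block-swap)

    midpoint-cong : ∀ {x y z x′ y′ z′} → x ≈ x′ → y ≈ y′ → z ≈ z′ →
                    midpoint x y z ≈ midpoint x′ y′ z′
    midpoint-cong p q r = reflexive (choose-cong _ _ λ _ →
      mk⇔ (Block-resp p q r) (Block-resp (sym p) (sym q) (sym r)))

    -- In a totally symmetric block all six orders are compatible, and the second component keeps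
    -- the two with the midpoint in the middle. On other blocks it holds vacuously.
    Chosen : Carrier → Carrier → Carrier → Set ℓ
    Chosen x y z = Compatible x y z × (Commuting x y z → y ≈ midpoint x y z)

    D : Pred DirectedTriple ℓ
    D t = Chosen (first t) (second t) (third t)

    D-respects-≈ₜ : D Respects _≈ₜ_
    D-respects-≈ₜ (p , q , r) (compatible , middle) =
      Compatible-resp p q r compatible ,
      λ com → trans (sym q) (trans (middle (Commuting-resp (sym p) (sym q) (sym r) com))
                                   (midpoint-cong p q r))

    -- The unique triple through a given arrow.

    module _ (a b : Carrier) (a≉b : a ≉ b) where

      a≉ab : a ≉ a ∙ b
      a≉ab a≈ab = a≉b (cancelˡ a a b (trans (idem a) a≈ab))

      b≉ab : b ≉ a ∙ b
      b≉ab b≈ab = a≉b (sym (cancelʳ b b a (trans (idem b) b≈ab)))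

      -- ‥ stands in the place of a ∙ b.
      data Position : Set where
        ab‥ ‥ab a‥b : Position

      triple : Position → DirectedTriple
      triple ab‥ = ⟨ a , b , a ∙ b ⟩[ a≉b , b≉ab , a≉ab ]
      triple ‥ab = ⟨ a ∙ b , a , b ⟩[ a≉ab ∘ sym , a≉b , b≉ab ∘ sym ]
      triple a‥b = ⟨ a , a ∙ b , b ⟩[ a≉ab , b≉ab ∘ sym , a≉b ]

      isArrow-triple : ∀ i → IsArrow a b (triple i)
      isArrow-triple ab‥ = inj₁ (refl , refl)
      isArrow-triple ‥ab = inj₂ (inj₁ (refl , refl))
      isArrow-triple a‥b = inj₂ (inj₂ (refl , refl))

      -- Compatibility forces the remaining point to be `a ∙ b`, which reduces uniqueness of triples
      -- to uniqueness among three positions.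
      position : ∀ t → t ∈ D → IsArrow a b t → ∃ λ i → triple i ≈ₜ t
      position t ((xy≈z , _) , _) (inj₁ (p , q)) =
        ab‥ , p , q , trans (∙-cong p q) xy≈z
      position t ((_ , yz≈x , _) , _) (inj₂ (inj₁ (p , q))) =
        ‥ab , trans (∙-cong p q) yz≈x , p , q
      position t ((_ , _ , xz≈y) , _) (inj₂ (inj₂ (p , q))) =
        a‥b , p , trans (∙-cong p q) xz≈y , q

      CompatibleAt CommutingAt : Position → Set ℓ
      CompatibleAt i = Compatible (first (triple i)) (second (triple i)) (third (triple i))
      CommutingAt i  = Commuting (first (triple i)) (second (triple i)) (third (triple i))

      midpointAt : Position → Carrier
      midpointAt i = midpoint (first (triple i)) (second (triple i)) (third (triple i))

      commutingAt : CommutingAt ab‥ → ∀ i → CommutingAt i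
      commutingAt com ab‥ = com
      commutingAt com ‥ab = Commuting-rotate (Commuting-rotate com)
      commutingAt com a‥b = Commuting-swap (Commuting-rotate (Commuting-rotate com))

      CommutingAt-ab‥ : ∀ i → CommutingAt i → CommutingAt ab‥
      CommutingAt-ab‥ ab‥ com = com
      CommutingAt-ab‥ ‥ab com = Commuting-rotate com
      CommutingAt-ab‥ a‥b com = Commuting-rotate (Commuting-swap com)

      midpointAt-const : ∀ i → midpointAt i ≈ midpointAt ab‥
      midpointAt-const ab‥ = refl
      midpointAt-const ‥ab = midpoint-rotate _ _ _
      midpointAt-const a‥b = midpoint-swap _ _ _

      midpoint-second : ∃ λ i → midpointAt ab‥ ≈ second (triple i)
      midpoint-second with midpoint∈Block a b (a ∙ b)
      ... | inj₁ m≈a         = ‥ab , m≈a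
      ... | inj₂ (inj₁ m≈b)  = ab‥ , m≈b
      ... | inj₂ (inj₂ m≈ab) = a‥b , m≈ab

      second-injective : ∀ i j → second (triple i) ≈ second (triple j) → i ≡ j
      second-injective ab‥ ab‥ _ = ≡.refl
      second-injective ‥ab ‥ab _ = ≡.refl
      second-injective a‥b a‥b _ = ≡.refl
      second-injective ab‥ ‥ab e = contradiction (sym e) a≉b
      second-injective ab‥ a‥b e = contradiction e b≉ab
      second-injective ‥ab ab‥ e = contradiction e a≉b
      second-injective ‥ab a‥b e = contradiction e a≉ab
      second-injective a‥b ab‥ e = contradiction (sym e) b≉ab
      second-injective a‥b ‥ab e = contradiction (sym e) a≉ab

      -- Two different compatible positions evaluate `a ∙ b` times `a`, or `a ∙ b` times `b`, in
      -- both orders to the same point. Rotating this commuting pair reaches `(a,b)`.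
      position-unique : ¬ Commuting a b (a ∙ b) →
                        ∀ i j → CompatibleAt i → CompatibleAt j → i ≡ j
      position-unique _ ab‥ ab‥ _ _ = ≡.refl
      position-unique _ ‥ab ‥ab _ _ = ≡.refl
      position-unique _ a‥b a‥b _ _ = ≡.refl
      position-unique ¬com ab‥ ‥ab (_ , _ , p) (q , _) =
        contradiction (Commuting-rotate (q , p)) ¬com
      position-unique ¬com ab‥ a‥b (_ , p , _) (_ , q , _) =
        contradiction (Commuting-rotate (Commuting-rotate (p , q))) ¬com
      position-unique ¬com ‥ab a‥b (p , _) (q , _) =
        contradiction (Commuting-rotate (p , q)) ¬com
      position-unique ¬com ‥ab ab‥ p q = ≡.sym (position-unique ¬com ab‥ ‥ab q p)
      position-unique ¬com a‥b ab‥ p q = ≡.sym (position-unique ¬com ab‥ a‥b q p)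
      position-unique ¬com a‥b ‥ab p q = ≡.sym (position-unique ¬com ‥ab a‥b q p)

      -- If `(a ∙ b) ∙ a ≈ b`, then (ii) supplies the remaining product for `‥ab`. Otherwise
      -- `a ∙ (a ∙ b) ≈ b`, and (i) for `(b,a)` tells on which side of `b` the point `a ∙ b` goes.
      compatiblePosition : ∃ CompatibleAt
      compatiblePosition with conditionI a b | conditionI b a
      ... | inj₂ (p , _) | _            = ‥ab , p , refl , conditionII a b p
      ... | inj₁ (p , _) | inj₁ (_ , q) = a‥b , p , sym q , refl
      ... | inj₁ (p , _) | inj₂ (_ , q) = ab‥ , refl , sym q , p

      exactlyOnePosition : ∃ λ i → triple i ∈ D × (∀ j → triple j ∈ D → i ≡ j)
      exactlyOnePosition with lower-em c em {CommutingAt ab‥}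
      -- Every position is compatible here, so the midpoint alone decides.
      ... | yes com =
        let i , mid≈second = midpoint-second in
        i , (Commuting⇒Compatible (commutingAt com i) ,
             λ _ → sym (trans (midpointAt-const i) mid≈second)) ,
        λ { j (_ , middle) → second-injective i j (sym
              (trans (middle (commutingAt com j)) (trans (midpointAt-const j) mid≈second))) }
      ... | no ¬com =
        let i , compatible = compatiblePosition in
        i , (compatible , λ com → contradiction (CommutingAt-ab‥ i com) ¬com) ,
        λ { j (compatible′ , _) → position-unique ¬com i j compatible compatible′ }

      exactlyOneTriple : ∃! _≈ₜ_ (λ t → t ∈ D × IsArrow a b t)
      exactlyOneTriple = let i , triple∈D , only = exactlyOnePosition in
        triple i , (triple∈D , isArrow-triple i) , λ { {t} (t∈D , arrow) →
          -- Membership in `D` passes from `t` to `triple j`, which identifies `j` with `i`.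
          let j , triple≈t@(p , q , r) = position t t∈D arrow in
          ≡.subst (λ k → triple k ≈ₜ t)
            (≡.sym (only j (D-respects-≈ₜ {t} {triple j} (sym p , sym q , sym r) t∈D)))
            triple≈t }

    D-induces : Induces D _∙_
    D-induces = record
      { idem = idem
      ; xy≈z = λ { _ ((p , _) , _) → p }
      ; yz≈x = λ { _ ((_ , p , _) , _) → p }
      ; xz≈y = λ { _ ((_ , _ , p) , _) → p }
      }

    isDTSQuasigroup : IsDTSQuasigroup Q
    isDTSQuasigroup = D , record
      { isDTS = record { respects-≈ₜ = λ {s} {t} → D-respects-≈ₜ {s} {t}
                       ; exactlyOne = exactlyOneTriple }
      ; latin = _∙_ , D-induces , _\\_ , _//_ , isQuasigroup
      } , D-induces

theorem1p6 : ∀ {c ℓ} → ExcludedMiddle (c ⊔ ℓ) → Extensionality c 0ℓ →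
    (Q : Quasigroup c ℓ) → let open Quasigroup Q in
    Idempotent _≈_ _∙_ →
    IsDTSQuasigroup Q ⇔
    (∀ x y →
    ((x ∙ (x ∙ y) ≈ y × y ≈ (y ∙ x) ∙ x) ⊎ ((x ∙ y) ∙ x ≈ y × y ≈ x ∙ (y ∙ x)))
    × ((x ∙ y) ∙ x ≈ y → (x ∙ y) ∙ y ≈ x))
theorem1p6 em ext Q idem = mk⇔
  (λ { (_ , isLDTS , induces) →
       DTS⇒Conditions.conditions Q em (IsLDTS.isDTS isLDTS) induces })
  (λ conditions → Conditions⇒DTS.isDTSQuasigroup Q em ext idem
       (λ x y → proj₁ (conditions x y)) (λ x y → proj₂ (conditions x y)))
  where
  open DirectedTriples (Quasigroup.setoid Q)
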